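{- Let $n$ be an integer, let $R$ be an incidence structure and let $P$ be a poset. Then: (1) $R\in\mathcal{F}_{\mathcal{S}}(n)$ if and only if $Gal(R)\in\mathcal{L}_{\mathcal{S}}(n)$; (2) $P\in\mathcal{I}_{\mathcal{S}}(n)$ if and only if $Gal((P,<,P))\in\mathcal{L}_{\mathcal{S}}(n)$; (3) $P\in\mathcal{L}_{\mathcal{S}}(n)$ if and only if $N(P)\in\mathcal{L}_{\mathcal{S}}(n)$.
   Context: A poset is scattered if it contains no induced subposet isomorphic to the chain of rational numbers. An incidence structure is a triple $R=(E,\rho,F)$ with $\rho\subseteq E\times F$. For $Y\subseteq F$, $L_R(Y):=\{x\in E: x\rho y\text{ for all }y\in Y\}$, and the Galois lattice is $Gal(R):=\{L_R(Y):Y\subseteq F\}$ ordered by inclusion. For a poset $P$, $N(P):=Gal((P,\leq,P))$ is its MacNeille completion, and $<$ denotes the strict order of $P$. For an integer $n$: $\mathcal{L}_{\mathcal{S}}(n)$ is the class of posets whose order is the intersection of at most $n$ scattered linear orders on the underlying set. $\mathcal{F}_{\mathcal{S}}(n)$ is the class of incidence structures $(E,\rho,F)$ such that $\rho$ is the intersection of at most $n$ relations $\rho'\subseteq E\times F$ such that $Gal((E,\rho',F))$ is a scattered chain. $\mathcal{I}_{\mathcal{S}}(n)$ is the class of posets $P$ whose order is the intersection of at most $n$ orders $\leq'$ on $P$ such that, with $<'$ the strict order associated with $\leq'$, $Gal((P,<',P))$ is a scattered chain. -}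

module Defs where

open import Data.Fin.Base using (Fin)
open import Data.Integer.Base using (ℤ; +_; _≤_)
open import Data.Nat.Base using (suc)
open import Data.Product.Base using (Σ-syntax; ∃-syntax; _×_; proj₁)
import Data.Rational.Properties as ℚ
open import Function.Bundles using (_⇔_)
open import Level using (Level; _⊔_) renaming (suc to lsuc)
open import Relation.Binary.Bundles using (Poset; TotalOrder; DecTotalOrder)
open import Relation.Binary.Core using (REL; Rel)
open import Relation.Binary.Definitions using (Total)
open import Relation.Binary.Structures using (IsPartialOrder; IsTotalOrder)
import Relation.Binary.Construct.NonStrictToStrict as ToStrict
import Relation.Binary.Construct.On as On
open import Relation.Binary.Morphism.Structures using (IsOrderIsomorphism)
open import Relation.Nullary.Negation.Core using (¬_)
open import Relation.Unary using (Pred; _∈_; _≐_)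
open import Relation.Unary.Relation.Binary.Subset using (⊆-poset)

private
  variable
    a b c ℓ ℓ₁ ℓ₂ ℓ₃ ℓ₄ : Level

infix 4 _≅_

_≅_ : Poset a ℓ₁ ℓ₂ → Poset b ℓ₃ ℓ₄ → Set (a ⊔ b ⊔ ℓ₁ ⊔ ℓ₂ ⊔ ℓ₃ ⊔ ℓ₄)
P ≅ Q = Σ[ f ∈ (P.Carrier → Q.Carrier) ] IsOrderIsomorphism P._≈_ Q._≈_ P._≤_ Q._≤_ f
  where
  module P = Poset P
  module Q = Poset Q

induced : (P : Poset a ℓ₁ ℓ₂) → Pred (Poset.Carrier P) c → Poset (a ⊔ c) ℓ₁ ℓ₂
induced P A = On.poset P (proj₁ {B = A})

-- The level ℓ₁ of A is enough to contain the image, up to _≈_, of any map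
-- from ℚ.
Scattered : Poset a ℓ₁ ℓ₂ → Set (a ⊔ lsuc ℓ₁ ⊔ ℓ₂)
Scattered {ℓ₁ = ℓ₁} P =
  ¬ (Σ[ A ∈ Pred (Poset.Carrier P) ℓ₁ ] DecTotalOrder.poset ℚ.≤-decTotalOrder ≅ induced P A)

ScatteredChain : Poset a ℓ₁ ℓ₂ → Set (a ⊔ lsuc ℓ₁ ⊔ ℓ₂)
ScatteredChain P = Total (Poset._≤_ P) × Scattered P

ScatteredLinearOrder : {A : Set a} → Rel A ℓ₁ → Rel A ℓ₂ → Set (a ⊔ lsuc ℓ₁ ⊔ ℓ₂)
ScatteredLinearOrder _≈_ _≤′_ =
  Σ[ isTotalOrder ∈ IsTotalOrder _≈_ _≤′_ ]
    Scattered (TotalOrder.poset (record { isTotalOrder = isTotalOrder }))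

-- The family has suc k members, with repetitions allowed: the intersection of
-- the empty family is left out. It would only matter for n = 0, where it would
-- put the one-element poset P in 𝓘𝓢 0 although Gal (P , < , P) is a two-element
-- chain, which is not in 𝓛𝓢 0.
IntersectionOfAtMost : {A : Set a} {B : Set b} →
                       ℤ → (REL A B ℓ → Set c) → REL A B ℓ → Set (a ⊔ b ⊔ c ⊔ lsuc ℓ)
IntersectionOfAtMost {ℓ = ℓ} {A = A} {B = B} n C ρ =
  ∃[ k ] (+ suc k ≤ n) ×
  (Σ[ σ ∈ (Fin (suc k) → REL A B ℓ) ]
    (∀ i → C (σ i)) × (∀ x y → ρ x y ⇔ (∀ i → σ i x y)))

record IncidenceStructure (ℓ : Level) : Set (lsuc ℓ) where
  field
    E F : Set ℓ
    ρ   : REL E F ℓ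

incidence : {E F : Set ℓ} → REL E F ℓ → IncidenceStructure ℓ
incidence ρ = record { ρ = ρ }

module _ (R : IncidenceStructure ℓ) where
  open IncidenceStructure R

  L : Pred F ℓ → Pred E ℓ
  L Y x = ∀ y → y ∈ Y → ρ x y

  Gal : Poset (lsuc ℓ) ℓ ℓ
  Gal = induced (⊆-poset E ℓ) (λ X → ∃[ Y ] X ≐ L Y)

strict : (P : Poset a ℓ₁ ℓ₂) → Rel (Poset.Carrier P) (ℓ₁ ⊔ ℓ₂)
strict P = ToStrict._<_ (Poset._≈_ P) (Poset._≤_ P)

-- The MacNeille completion.
N : Poset ℓ ℓ ℓ → Poset (lsuc ℓ) ℓ ℓ
N P = Gal (incidence (Poset._≤_ P))

𝓛𝓢 : ℤ → Poset a ℓ₁ ℓ₂ → Set (a ⊔ lsuc ℓ₁ ⊔ lsuc ℓ₂)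
𝓛𝓢 n P = IntersectionOfAtMost n (ScatteredLinearOrder _≈_) _≤ᴾ_
  where open Poset P using (_≈_) renaming (_≤_ to _≤ᴾ_)

𝓕𝓢 : ℤ → IncidenceStructure ℓ → Set (lsuc ℓ)
𝓕𝓢 n R = IntersectionOfAtMost n (λ ρ′ → ScatteredChain (Gal (incidence ρ′))) ρ
  where open IncidenceStructure R

𝓘𝓢 : ℤ → Poset ℓ ℓ ℓ → Set (lsuc ℓ)
𝓘𝓢 n P = IntersectionOfAtMost n ScatteredIntervalOrder _≤ᴾ_
  where
  open Poset P using (Carrier; _≈_) renaming (_≤_ to _≤ᴾ_)

  ScatteredIntervalOrder : Rel Carrier _ → Set _
  ScatteredIntervalOrder _≤′_ =
    IsPartialOrder _≈_ _≤′_ × ScatteredChain (Gal (incidence (ToStrict._<_ _≈_ _≤′_)))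

{-# OPTIONS --safe #-}

-- A chain is scattered iff no ψ from ℚ is strictly increasing in it. This makes
-- sense for total preorders, and there it has two stability properties.
-- * If ρ x y ⇔ h x ≲ g y for a scattered total preorder ≲, then Gal ρ is a
--   scattered chain. Given a copy (X q) of ℚ in Gal ρ, put x ≺ x′ when X q
--   contains x but not x′ for some q in the copy, with room to spare. This
--   order on points is dense, so Cantor's argument embeds ℚ in it, and h is
--   strictly increasing on ≺.
-- * A lexicographic product of finitely many scattered total preorders is
--   scattered: either the first coordinate is injective on ℚ, or it is constant
--   on an interval, which contains another copy of ℚ. Hence a poset whose order
--   is an intersection of scattered total preorders is an intersection of as
--   many scattered linear orders.
-- The equivalences follow by transporting a realizer: from ρᵢ to inclusion of
-- the ρᵢ-closures; from ≤ᵢ on Gal R to x ρᵢ y ⇔ cl x ≤ᵢ L {y}; and, for the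
-- interval orders, x <ᵢ y ⇔ max (L {x} , cl x) ≤ᵢ min (L {y} , cl y).

module Submission where

open import Defs
import Algebra.Construct.NaturalChoice.Max as Max
import Algebra.Construct.NaturalChoice.Min as Min
open import Axiom.ExcludedMiddle using (ExcludedMiddle)
open import Axiom.DoubleNegationElimination using (em⇒dne)
open import Data.Fin.Base using (Fin; zero; suc)
open import Data.Integer.Base using (ℤ; +_; -[1+_]; _⊖_)
open import Data.Nat.Base as ℕ using (ℕ; zero; suc; _+_)
import Data.Nat.Properties as ℕ
open import Data.Product.Base using (Σ-syntax; ∃-syntax; _×_; _,_; proj₁; proj₂)
open import Data.Rational.Base using (ℚ; mkℚ; 1ℚ; _/_; _<_) renaming (_≤_ to _≤ᵠ_)
import Data.Rational.Properties as ℚ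
open import Data.Sum.Base using (_⊎_; inj₁; inj₂; [_,_]′)
open import Data.Unit.Polymorphic.Base using (⊤)
open import Function.Base using (_∘_; _on_; id)
open import Function.Bundles using (_⇔_; mk⇔; module Equivalence)
open import Level using (Level; _⊔_)
open import Relation.Binary.Bundles using (Poset; TotalOrder; DecTotalOrder)
import Relation.Binary.Construct.NonStrictToStrict as ToStrict
import Relation.Binary.Construct.StrictToNonStrict as ToNonStrict
open import Relation.Binary.Core using (REL; Rel)
open import Relation.Binary.Definitions
  using (Reflexive; Transitive; Total; Dense; Tri; tri<; tri≈; tri>)
open import Relation.Binary.Morphism.Structures using (module IsOrderIsomorphism)
open import Relation.Binary.PropositionalEquality
  using (_≡_; _≢_; refl; sym; trans; cong; subst)
open import Relation.Binary.Structures using (IsTotalOrder; IsStrictPartialOrder)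
open import Relation.Nullary using (¬_; yes; no; contradiction)
open import Relation.Unary using (Pred; _∈_; _∉_; _⊆_; _⊈_; _≐_; ｛_｝)

open Equivalence using (to; from)

private
  variable
    a b c ℓ ℓ₁ ℓ₂ : Level
    A : Set a
    B : Set b

-- An enumeration of ℚ

-- Walks down an antidiagonal `x + y = s` from `(0 , s)` to `(s , 0)`, then jumps to the next one.
next : ℕ × ℕ → ℕ × ℕ
next (x , zero)  = zero , suc x
next (x , suc y) = suc x , y

diagonal : ℕ → ℕ × ℕ
diagonal zero    = 0 , 0
diagonal (suc n) = next (diagonal n)

diagonal-surjective : ∀ x y → ∃[ n ] diagonal n ≡ (x , y)
diagonal-surjective x y = along x y (start (x + y))
  where
  along : ∀ x y → ∃[ n ] diagonal n ≡ (zero , x + y) → ∃[ n ] diagonal n ≡ (x , y)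
  along zero    y h = h
  along (suc x) y (n , eq) =
    let m , eq′ = along x (suc y) (n , trans eq (cong (zero ,_) (sym (ℕ.+-suc x y))))
    in suc m , cong next eq′

  start : ∀ s → ∃[ n ] diagonal n ≡ (zero , s)
  start zero    = 0 , refl
  start (suc s) =
    let n , eq = along s 0 (subst (λ t → ∃[ n ] diagonal n ≡ (zero , t))
                                  (sym (ℕ.+-identityʳ s)) (start s))
    in suc n , cong next eq

difference-surjective : ∀ i → ∃[ n ] proj₁ (diagonal n) ⊖ proj₂ (diagonal n) ≡ i
difference-surjective (+ m) =
  let n , eq = diagonal-surjective m 0
  in n , cong (λ (x , y) → x ⊖ y) eq
difference-surjective -[1+ m ] =
  let n , eq = diagonal-surjective 0 (suc m)
  in n , cong (λ (x , y) → x ⊖ y) eq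

-- The numerator is coded as a difference of naturals, and `suc d` keeps the denominator positive.
-- Rationals repeat; only surjectivity matters.
fraction : ℕ × ℕ → ℚ
fraction (x , d) = (proj₁ (diagonal x) ⊖ proj₂ (diagonal x)) / suc d

enum : ℕ → ℚ
enum n = fraction (diagonal n)

enum-surjective : ∀ q → ∃[ n ] enum n ≡ q
enum-surjective q@(mkℚ i d-1 _) =
  let m , eq  = difference-surjective i
      n , eq′ = diagonal-surjective m d-1
  in n , trans (cong fraction eq′) (trans (cong (_/ suc d-1) eq) (ℚ.↥p/↧p≡p q))

rank : ℚ → ℕ
rank q = proj₁ (enum-surjective q)

enum-rank : ∀ q → enum (rank q) ≡ q
enum-rank q = proj₂ (enum-surjective q)

-- Cantor's embedding of ℚ in a dense order

module _ {D : Set a} {_≺_ : Rel D ℓ} (≺-trans : Transitive _≺_) (dense : Dense _≺_) where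

  private
    record Interval : Set (a ⊔ ℓ) where
      constructor ⟨_⟩
      field
        {lower upper} : D
        lower≺upper   : lower ≺ upper

    open Interval

    -- I ⊑ J says that I lies in J, and I ◁ J that upper I is equal to or below
    -- lower J; both are phrased to avoid the reflexive closure of _≺_.
    _⊑_ _◁_ : Rel Interval (a ⊔ ℓ)
    I ⊑ J = (∀ {z} → z ≺ upper I → z ≺ upper J) × (∀ {z} → lower I ≺ z → lower J ≺ z)
    I ◁ J = ∀ {x y} → x ≺ upper I → lower J ≺ y → x ≺ y

    ⊑-refl : Reflexive _⊑_
    ⊑-refl = id , id

    ⊑-trans : Transitive _⊑_
    ⊑-trans (f , g) (f′ , g′) = f′ ∘ f , g′ ∘ g

    ◁-shrink : ∀ {I I′ J J′} → I ⊑ I′ → J ⊑ J′ → I′ ◁ J′ → I ◁ J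
    ◁-shrink (f , _) (_ , g) I′◁J′ x≺ ≺y = I′◁J′ (f x≺) (g ≺y)

    -- Three consecutive pieces, cut by two points from `dense`. Neighbours share an endpoint, so
    -- `_◁_` between them is just `≺-trans`.
    left middle right : Interval → Interval
    left   ⟨ l ⟩ = ⟨ proj₁ (proj₂ (dense l)) ⟩
    middle ⟨ l ⟩ = left ⟨ proj₂ (proj₂ (dense l)) ⟩
    right  ⟨ l ⟩ = ⟨ proj₂ (proj₂ (dense (proj₂ (proj₂ (dense l))))) ⟩

    refine : ∀ {p q} → Tri (p < q) (p ≡ q) (q < p) → Interval → Interval
    refine (tri< _ _ _) = left
    refine (tri≈ _ _ _) = middle
    refine (tri> _ _ _) = right

    refine-⊑ : ∀ {p q} (t : Tri (p < q) (p ≡ q) (q < p)) I → refine t I ⊑ I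
    refine-⊑ (tri< _ _ _) I =
      (λ z≺ → ≺-trans z≺ (≺-trans (lower≺upper (middle I)) (lower≺upper (right I)))) , id
    refine-⊑ (tri≈ _ _ _) I =
      (λ z≺ → ≺-trans z≺ (lower≺upper (right I))) , (λ ≺z → ≺-trans (lower≺upper (left I)) ≺z)
    refine-⊑ (tri> _ _ _) I =
      id , (λ ≺z → ≺-trans (lower≺upper (left I)) (≺-trans (lower≺upper (middle I)) ≺z))

    -- As `p < q`, the piece chosen for `p` is never to the right of that for `q`. Equal pieces mean
    -- that both lie strictly on one side of `c`; recording `c ≢ p` and `c ≢ q` rules this case out
    -- once `c` is `p` or `q`.
    refine-◁ : ∀ {p q c} I → p < q →
               (s : Tri (p < c) (p ≡ c) (c < p)) (t : Tri (q < c) (q ≡ c) (c < q)) →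
               (c ≢ p × c ≢ q × refine s I ≡ refine t I) ⊎ refine s I ◁ refine t I
    refine-◁ I p<q (tri< _ p≢c _) (tri< _ q≢c _) = inj₁ (p≢c ∘ sym , q≢c ∘ sym , refl)
    refine-◁ I p<q (tri< _ _ _)   (tri≈ _ _ _)   = inj₂ ≺-trans
    refine-◁ I p<q (tri< _ _ _)   (tri> _ _ _)   =
      inj₂ λ x≺ ≺y → ≺-trans x≺ (≺-trans (lower≺upper (middle I)) ≺y)
    refine-◁ I p<q (tri≈ _ refl _) (tri< q<p _ _) = contradiction q<p (ℚ.<-asym p<q)
    refine-◁ I p<q (tri≈ _ refl _) (tri≈ _ refl _) = contradiction p<q (ℚ.<-irrefl refl)
    refine-◁ I p<q (tri≈ _ _ _)   (tri> _ _ _)   = inj₂ ≺-trans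
    refine-◁ I p<q (tri> _ _ c<p) (tri< q<c _ _) =
      contradiction (ℚ.<-trans p<q q<c) (ℚ.<-asym c<p)
    refine-◁ I p<q (tri> _ _ c<p) (tri≈ _ refl _) = contradiction c<p (ℚ.<-asym p<q)
    refine-◁ I p<q (tri> _ p≢c _) (tri> _ q≢c _) = inj₁ (p≢c ∘ sym , q≢c ∘ sym , refl)

    module _ {x₀ y₀} (x₀≺y₀ : x₀ ≺ y₀) where

      interval : ℚ → ℕ → Interval
      interval q zero    = ⟨ x₀≺y₀ ⟩
      interval q (suc n) = refine (ℚ.<-cmp q (enum n)) (interval q n)

      interval-⊑ : ∀ q {m n} → m ℕ.≤′ n → interval q n ⊑ interval q m
      interval-⊑ q {m} ℕ.≤′-refl = ⊑-refl {interval q m}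
      interval-⊑ q {m} {suc n} (ℕ.≤′-step m≤n) =
        ⊑-trans {interval q (suc n)} {interval q n} {interval q m}
          (refine-⊑ (ℚ.<-cmp q (enum n)) (interval q n)) (interval-⊑ q m≤n)

      compare : ∀ {p q} → p < q → ∀ n →
                interval p n ≡ interval q n ⊎ interval p n ◁ interval q n
      compare-suc : ∀ {p q} → p < q → ∀ n →
                    (enum n ≢ p × enum n ≢ q × interval p (suc n) ≡ interval q (suc n)) ⊎
                    interval p (suc n) ◁ interval q (suc n)

      compare p<q zero    = inj₁ refl
      compare p<q (suc n) = [ (λ (_ , _ , eq) → inj₁ eq) , inj₂ ]′ (compare-suc p<q n)

      compare-suc {p} {q} p<q n with compare p<q n
      ... | inj₂ p◁q = inj₂ (◁-shrink
                         {interval p (suc n)} {interval p n} {interval q (suc n)} {interval q n}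
                         (refine-⊑ (ℚ.<-cmp p (enum n)) (interval p n))
                         (refine-⊑ (ℚ.<-cmp q (enum n)) (interval q n)) p◁q)
      ... | inj₁ eq rewrite eq =
        refine-◁ (interval q n) p<q (ℚ.<-cmp p (enum n)) (ℚ.<-cmp q (enum n))

      -- At stage suc (rank q) the comparison with q itself has separated q from
      -- every other rational: q alone has gone to the middle.
      ℚ→D : ℚ → D
      ℚ→D q = upper (left (interval q (suc (rank q))))

      ℚ→D-mono : ∀ {p q} → p < q → ℚ→D p ≺ ℚ→D q
      ℚ→D-mono {p} {q} p<q = bounds (ℕ.≤-total (rank p) (rank q))
        where
        separated : ∀ {n} → suc n ℕ.≤ suc (rank p) → suc n ℕ.≤ suc (rank q) →
                    interval p (suc n) ◁ interval q (suc n) → ℚ→D p ≺ ℚ→D q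
        separated {n} n≤p n≤q p◁q =
          ◁-shrink {I} {interval p (suc n)} {J} {interval q (suc n)}
            (interval-⊑ p (ℕ.≤⇒≤′ n≤p)) (interval-⊑ q (ℕ.≤⇒≤′ n≤q)) p◁q
            -- The chosen points lie strictly inside `I` and `J`, which is what `_◁_` asks for.
            (≺-trans (lower≺upper (middle I)) (lower≺upper (right I)))
            (lower≺upper (left J))
          where
          I = interval p (suc (rank p))
          J = interval q (suc (rank q))

        bounds : rank p ℕ.≤ rank q ⊎ rank q ℕ.≤ rank p → ℚ→D p ≺ ℚ→D q
        bounds (inj₁ p≤q) with compare-suc p<q (rank p)
        ... | inj₁ (≢p , _) = contradiction (enum-rank p) ≢p
        ... | inj₂ p◁q      = separated ℕ.≤-refl (ℕ.s≤s p≤q) p◁q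
        bounds (inj₂ q≤p) with compare-suc p<q (rank q)
        ... | inj₁ (_ , ≢q , _) = contradiction (enum-rank q) ≢q
        ... | inj₂ p◁q          = separated (ℕ.s≤s q≤p) ℕ.≤-refl p◁q

  cantor : ∀ {x y} → x ≺ y → Σ[ f ∈ (ℚ → D) ] (∀ {p q} → p < q → f p ≺ f q)
  cantor x≺y = ℚ→D x≺y , ℚ→D-mono x≺y

-- Scattered total preorders

ℚChain : {A : Set a} → Rel A ℓ → Set (a ⊔ ℓ)
ℚChain {A = A} _≲_ = Σ[ ψ ∈ (ℚ → A) ] (∀ {p q} → p < q → ¬ ψ q ≲ ψ p)

record ScatteredPreorder {A : Set a} (_≲_ : Rel A ℓ) : Set (a ⊔ ℓ) where
  field
    ≲-trans   : Transitive _≲_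
    total     : Total _≲_
    scattered : ¬ ℚChain _≲_

open ScatteredPreorder

on-scattered : {_≲_ : Rel B ℓ} (f : A → B) → ScatteredPreorder _≲_ → ScatteredPreorder (_≲_ on f)
on-scattered f S = record
  { ≲-trans   = ≲-trans S
  ; total     = λ x y → total S (f x) (f y)
  ; scattered = λ (ψ , ψ-mono) → scattered S (f ∘ ψ , ψ-mono)
  }

module _ (P : Poset a ℓ₁ ℓ₂) where
  open Poset P hiding (refl; trans)

  ¬ℚChain⇒scattered : ¬ ℚChain _≤_ → Scattered P
  ¬ℚChain⇒scattered ¬chain (A , f , iso) =
    ¬chain (proj₁ ∘ f , λ p<q fq≤fp → ℚ.<-irrefl refl (ℚ.<-≤-trans p<q (cancel fq≤fp)))
    where open IsOrderIsomorphism iso using (cancel)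

  scatteredChain⇒preorder : ScatteredChain P → ScatteredPreorder _≤_
  scatteredChain⇒preorder (tot , scat) = record
    { ≲-trans   = Poset.trans P
    ; total     = tot
    ; scattered = λ chain → scat (image chain)
    }
    where
    image : ℚChain _≤_ →
            Σ[ A ∈ Pred Carrier ℓ₁ ] DecTotalOrder.poset ℚ.≤-decTotalOrder ≅ induced P A
    image (ψ , ψ-mono) = (λ x → ∃[ q ] ψ q ≈ x) , (λ q → ψ q , q , Eq.refl) , record
      { isOrderMonomorphism = record
        { isOrderHomomorphism = record
          -- For `mono`: if totality gives the opposite comparison, `cancel` forces `p ≡ q`.
          { cong = λ { refl → Eq.refl }
          ; mono = λ {p} {q} p≤q → [ id , (λ ψq≤ψp →
                     reflexive (Eq.reflexive (cong ψ (ℚ.≤-antisym p≤q (cancel ψq≤ψp))))) ]′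
                     (tot (ψ p) (ψ q))
          }
        ; injective = λ ψp≈ψq → ℚ.≤-antisym (cancel (reflexive ψp≈ψq))
                                            (cancel (reflexive (Eq.sym ψp≈ψq)))
        ; cancel    = cancel
        }
      ; surjective = λ (x , q , ψq≈x) → q , λ { refl → ψq≈x }
      }
      where
      cancel : ∀ {p q} → ψ p ≤ ψ q → p ≤ᵠ q
      cancel ψp≤ψq = ℚ.≮⇒≥ (λ q<p → ψ-mono q<p ψp≤ψq)

linear⇒preorder : {_≈_ : Rel A ℓ₁} {_≤′_ : Rel A ℓ₂} →
                  ScatteredLinearOrder _≈_ _≤′_ → ScatteredPreorder _≤′_
linear⇒preorder (isTotal , scat) =
  scatteredChain⇒preorder (TotalOrder.poset (record { isTotalOrder = isTotal }))
    (IsTotalOrder.total isTotal , scat)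

-- The lexicographic preorder: the second relation is consulted only on ties of the first.
Lex₂ : Rel A ℓ → Rel A ℓ → Rel A ℓ
Lex₂ _≲₁_ _≲₂_ x y = x ≲₁ y × (y ≲₁ x → x ≲₂ y)

Lex : ∀ k → (Fin k → Rel A ℓ) → Rel A ℓ
Lex zero    _   = λ _ _ → ⊤
Lex (suc k) _≲_ = Lex₂ (_≲_ zero) (Lex k (_≲_ ∘ suc))

lex-intro : ∀ {k} (_≲_ : Fin k → Rel A ℓ) {x y} → (∀ i → (_≲_ i) x y) → Lex k _≲_ x y
lex-intro {k = zero}  _≲_ x≲y = _
lex-intro {k = suc k} _≲_ x≲y = x≲y zero , λ _ → lex-intro (_≲_ ∘ suc) (x≲y ∘ suc)

lex-antisym : ∀ {k} (_≲_ : Fin k → Rel A ℓ) {x y} →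
              Lex k _≲_ x y → Lex k _≲_ y x → ∀ i → (_≲_ i) x y
lex-antisym _≲_ (x≲y , _)  (y≲x , _)  zero    = x≲y
lex-antisym _≲_ (x≲y , xy) (y≲x , yx) (suc i) = lex-antisym (_≲_ ∘ suc) (xy y≲x) (yx x≲y) i

-- Closures in an incidence structure

module _ (R : IncidenceStructure ℓ) where
  open IncidenceStructure R

  column : F → Poset.Carrier (Gal R)
  column y = (λ x → ρ x y) , ｛ y ｝ , (λ { xρy _ refl → xρy }) , λ x∈L → x∈L y refl

  closure : E → Poset.Carrier (Gal R)
  closure x = L R (ρ x) , ρ x , id , id

  -- `closure x` is the least closed set containing `x`, and `column y` is closed.
  ρ⇔closure⊆column : ∀ x y → ρ x y ⇔ proj₁ (closure x) ⊆ proj₁ (column y)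
  ρ⇔closure⊆column x y = mk⇔ (λ xρy {_} z∈cl → z∈cl y xρy) (λ cl⊆ → cl⊆ (λ _ → id))

  Upper : Pred E ℓ → Pred F ℓ
  Upper X y = ∀ x → x ∈ X → ρ x y

  L-Upper⊆ : ((X , _) : Poset.Carrier (Gal R)) → L R (Upper X) ⊆ X
  L-Upper⊆ (X , Y , X⊆LY , LY⊆X) z∈ = LY⊆X (λ y y∈Y → z∈ y (λ x x∈X → X⊆LY x∈X y y∈Y))

module _ (em : ∀ {a} → ExcludedMiddle a) where

  private
    dne : {A : Set a} → ¬ ¬ A → A
    dne = em⇒dne em

  ⊈⇒witness : {X Y : Pred A ℓ} → X ⊈ Y → ∃[ x ] x ∈ X × x ∉ Y
  ⊈⇒witness X⊈Y = dne λ none → X⊈Y λ {x} x∈X → dne λ x∉Y → none (x , x∈X , x∉Y)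

  -- Lexicographic products and linear refinements

  lex₂-scattered : {_≲₁_ _≲₂_ : Rel A ℓ} →
                   ScatteredPreorder _≲₁_ → ScatteredPreorder _≲₂_ →
                   ScatteredPreorder (Lex₂ _≲₁_ _≲₂_)
  lex₂-scattered {_≲₁_ = _≲₁_} {_≲₂_} S₁ S₂ = record
    { ≲-trans   = λ (x≲y , xy) (y≲z , yz) →
        ≲-trans S₁ x≲y y≲z ,
        λ z≲x → ≲-trans S₂ (xy (≲-trans S₁ y≲z z≲x)) (yz (≲-trans S₁ z≲x x≲y))
    ; total     = lex-total
    ; scattered = lex-¬ℚChain
    }
    where
    lex-total : Total (Lex₂ _≲₁_ _≲₂_)
    lex-total x y with em {P = x ≲₁ y} | em {P = y ≲₁ x}
    ... | no x≴y  | _       = inj₂ ([ (λ x≲y → contradiction x≲y x≴y) , id ]′ (total S₁ x y) ,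
                                    λ x≲y → contradiction x≲y x≴y)
    ... | yes x≲y | no y≴x  = inj₁ (x≲y , λ y≲x → contradiction y≲x y≴x)
    ... | yes x≲y | yes y≲x =
      [ (λ xy → inj₁ (x≲y , λ _ → xy)) , (λ yx → inj₂ (y≲x , λ _ → yx)) ]′ (total S₂ x y)

    lex-¬ℚChain : ¬ ℚChain (Lex₂ _≲₁_ _≲₂_)
    lex-¬ℚChain (ψ , ψ-mono) with em {P = ∃[ p ] ∃[ q ] p < q × ψ q ≲₁ ψ p}
    ... | no none = scattered S₁ (ψ , λ p<q ψq≲ψp → none (_ , _ , p<q , ψq≲ψp))
    -- Here the first coordinate is constant between `p` and `q`, so `ψ` is strictly increasing
    -- there for the second.
    ... | yes (p , q , p<q , ψq≲ψp) =
      scattered S₂ (ψ ∘ proj₁ ∘ f , λ {r} {s} r<s ψs≲ψr →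
        ψ-mono (f-mono r<s) (constant (f s) (f r) , λ _ → ψs≲ψr))
      where
      Between : Set
      Between = Σ[ r ∈ ℚ ] p < r × r < q

      between-dense : Dense (_<_ on proj₁ {B = λ r → p < r × r < q})
      between-dense {_ , p<r , _} {_ , _ , s<q} r<s =
        let t , r<t , t<s = ℚ.<-dense r<s
        in (t , ℚ.<-trans p<r r<t , ℚ.<-trans t<s s<q) , r<t , t<s

      embedding : Σ[ f ∈ (ℚ → Between) ] (∀ {r s} → r < s → proj₁ (f r) < proj₁ (f s))
      embedding =
        let r , p<r , r<q = ℚ.<-dense p<q
            s , r<s , s<q = ℚ.<-dense r<q
        in cantor ℚ.<-trans (λ {x y} → between-dense {x} {y})
             {r , p<r , r<q} {s , ℚ.<-trans p<r r<s , s<q} r<s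

      f : ℚ → Between
      f = proj₁ embedding

      f-mono : ∀ {r s} → r < s → proj₁ (f r) < proj₁ (f s)
      f-mono = proj₂ embedding

      ψ-mono₁ : ∀ {r s} → r < s → ψ r ≲₁ ψ s
      ψ-mono₁ {r} {s} r<s =
        [ proj₁ , (λ sr → contradiction sr (ψ-mono r<s)) ]′ (lex-total (ψ r) (ψ s))

      constant : ((s , _) (r , _) : Between) → ψ s ≲₁ ψ r
      constant (s , _ , s<q) (r , p<r , _) =
        ≲-trans S₁ (ψ-mono₁ s<q) (≲-trans S₁ ψq≲ψp (ψ-mono₁ p<r))

  lex-scattered : ∀ k {_≲_ : Fin k → Rel A ℓ} →
                  (∀ i → ScatteredPreorder (_≲_ i)) → ScatteredPreorder (Lex k _≲_)
  lex-scattered zero    S = record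
    { ≲-trans   = _
    ; total     = λ _ _ → inj₁ _
    ; scattered = λ (ψ , ψ-mono) →
        ψ-mono (proj₂ (proj₂ (ℚ.<-dense (ℚ.positive⁻¹ 1ℚ)))) _
    }
  lex-scattered (suc k) S = lex₂-scattered (S zero) (lex-scattered k (S ∘ suc))

  -- Ties of each preorder are broken by the lexicographic product of all of them. Elements still
  -- tied agree in every coordinate, hence are equal in `P`.
  preorders⇒𝓛𝓢 : (P : Poset a ℓ₁ ℓ₂) (n : ℤ) →
                  IntersectionOfAtMost n ScatteredPreorder (Poset._≤_ P) → 𝓛𝓢 n P
  preorders⇒𝓛𝓢 {ℓ₂ = ℓ₂} P n (k , k≤n , _≲_ , S , ≤⇔) =
    k , k≤n , _≤ᵢ_ , (λ i → isTotal i , ¬ℚChain⇒scattered (poset i) (scattered (T i))) ,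
    λ x y → mk⇔ (λ x≤y i → to (≤⇔ x y) x≤y i , λ _ → lex-intro _≲_ (to (≤⇔ x y) x≤y))
                (λ x≤y → from (≤⇔ x y) (λ i → proj₁ (x≤y i)))
    where
    open Poset P hiding (refl; trans)

    -- The i-th coordinate comes first, so that ≤ᵢ is contained in ≲ᵢ; the
    -- others only break ties.
    _≤ᵢ_ : Fin (suc k) → Rel Carrier ℓ₂
    _≤ᵢ_ i = Lex₂ (_≲_ i) (Lex (suc k) _≲_)

    T : ∀ i → ScatteredPreorder (_≤ᵢ_ i)
    T i = lex₂-scattered (S i) (lex-scattered (suc k) S)

    isTotal : ∀ i → IsTotalOrder _≈_ (_≤ᵢ_ i)
    isTotal i = record
      { isPartialOrder = record
        { isPreorder = record
          { isEquivalence = isEquivalence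
          ; reflexive     = λ {x} {y} x≈y → let x≲y = to (≤⇔ x y) (reflexive x≈y)
                                            in x≲y i , λ _ → lex-intro _≲_ x≲y
          ; trans         = ≲-trans (T i)
          }
        ; antisym = λ (x≲y , xy) (y≲x , yx) →
            antisym (from (≤⇔ _ _) (lex-antisym _≲_ (xy y≲x) (yx x≲y)))
                    (from (≤⇔ _ _) (lex-antisym _≲_ (yx x≲y) (xy y≲x)))
        }
      ; total = total (T i)
      }

    poset : Fin (suc k) → Poset _ _ _
    poset i = TotalOrder.poset (record { isTotalOrder = isTotal i })

  -- Galois lattices represented in a scattered preorder

  module _ {C : Set c} {_≲_ : Rel C ℓ₁} (S : ScatteredPreorder _≲_)
           {E F : Set ℓ} {ρ : REL E F ℓ} (h : E → C) (g : F → C)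
           (ρ⇔ : ∀ x y → ρ x y ⇔ h x ≲ g y) where

    private
      G : Poset _ _ _
      G = Gal (incidence ρ)

      -- Each column of `ρ` is an initial segment along `h`, hence so is every intersection of
      -- columns.
      lower-set : ((X , _) : Poset.Carrier G) → ∀ {x x′} → h x′ ≲ h x → x ∈ X → x′ ∈ X
      lower-set (X , Y , X⊆LY , LY⊆X) x′≲x x∈X =
        LY⊆X λ y y∈Y → from (ρ⇔ _ y) (≲-trans S x′≲x (to (ρ⇔ _ y) (X⊆LY x∈X y y∈Y)))

      G-total : Total (Poset._≤_ G)
      G-total U V with em {P = proj₁ U ⊆ proj₁ V}
      ... | yes U⊆V = inj₁ U⊆V
      ... | no  U⊈V = let x , x∈U , x∉V = ⊈⇒witness U⊈V in
        inj₂ λ {x′} x′∈V → lower-set U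
          ([ (λ x≲x′ → contradiction (lower-set V x≲x′ x′∈V) x∉V) , id ]′ (total S (h x) (h x′)))
          x∈U

      G-¬ℚChain : ¬ ℚChain (Poset._≤_ G)
      G-¬ℚChain (U , U-mono) = scattered S (h ∘ proj₁ f , λ p<q → ≺⇒≴ (proj₂ f p<q))
        where
        X : ℚ → Pred E ℓ
        X q = proj₁ (U q)

        X-mono : ∀ {p q} → p < q → X p ⊆ X q
        X-mono {p} {q} p<q = [ (λ s → s) , (λ s → contradiction (λ {x} → s {x}) (U-mono p<q)) ]′
          (G-total (U p) (U q))

        _≺_ : Rel E ℓ
        x ≺ x′ = ∃[ p ] ∃[ q ] p < q × x ∈ X p × x′ ∉ X q

        gap : ∀ {p q} → p < q → ∃[ x ] x ∈ X q × x ∉ X p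
        gap p<q = ⊈⇒witness (U-mono p<q)

        ≺-trans : Transitive _≺_
        ≺-trans (p , q , p<q , x∈p , y∉q) (r , s , r<s , y∈r , z∉s) =
          p , s , ℚ.<-trans p<q (ℚ.<-trans q<r r<s) , x∈p , z∉s
          where
          q<r : q < r
          -- `y` is in `X r` but not in `X q`, and `X` is increasing.
          q<r with ℚ.<-cmp q r
          ... | tri< q<r _ _    = q<r
          ... | tri≈ _ refl _   = contradiction y∈r y∉q
          ... | tri> _ _ r<q    = contradiction (X-mono r<q y∈r) y∉q

        ≺-dense : Dense _≺_
        ≺-dense (p , q , p<q , x∈p , y∉q) =
          let r , p<r , r<q = ℚ.<-dense p<q
              s , r<s , s<q = ℚ.<-dense r<q
              z , z∈s , z∉r = gap r<s
          in z , (p , r , p<r , x∈p , z∉r) , (s , q , s<q , z∈s , y∉q)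

        f : Σ[ f ∈ (ℚ → E) ] (∀ {p q} → p < q → f p ≺ f q)
        -- `cantor` needs one pair to start from: points of the gaps on either side of `q < r`.
        f = let p<s = ℚ.positive⁻¹ 1ℚ
                q , p<q , q<s = ℚ.<-dense p<s
                r , q<r , r<s = ℚ.<-dense q<s
                x , x∈q , _   = gap p<q
                y , _ , y∉r   = gap r<s
            in cantor ≺-trans ≺-dense (q , r , q<r , x∈q , y∉r)

        ≺⇒≴ : ∀ {x x′} → x ≺ x′ → ¬ h x′ ≲ h x
        ≺⇒≴ (p , q , p<q , x∈p , x′∉q) x′≲x = x′∉q (X-mono p<q (lower-set (U p) x′≲x x∈p))

    represented⇒scatteredChain : ScatteredChain G
    represented⇒scatteredChain = G-total , ¬ℚChain⇒scattered G G-¬ℚChain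

  -- Transport of realizers

  module _ (n : ℤ) where

    𝓕𝓢⇒𝓛𝓢 : (R : IncidenceStructure ℓ) → 𝓕𝓢 n R → 𝓛𝓢 n (Gal R)
    𝓕𝓢⇒𝓛𝓢 R (k , k≤n , ρᵢ , chains , ρ⇔) = preorders⇒𝓛𝓢 (Gal R) n
      ( k , k≤n , (λ i → (λ U V → U ⊆ V) on hull i)
      , (λ i → on-scattered {_≲_ = Poset._≤_ (Gal (incidence (ρᵢ i)))}
                 (λ U → hull i U , Upper R (proj₁ U) , id , id)
                 (scatteredChain⇒preorder (Gal (incidence (ρᵢ i))) (chains i)))
      , λ U V → mk⇔
          (λ U⊆V i {_} x∈ y y∈ → x∈ y (λ x x∈U → y∈ x (U⊆V x∈U)))
          -- A point of `U` lies in every `hull i V`, so it is `ρᵢ`-related, for all `i`, to each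
          -- bound `y` of `V`; hence `ρ x y`, and closedness of `V` concludes.
          (λ h {x} x∈U → L-Upper⊆ R V λ y y∈ → from (ρ⇔ x y) λ i →
             h i {x} (λ y′ y′∈ → to (ρ⇔ x y′) (y′∈ x x∈U) i) y y∈)
      )
      where
      -- The bounds are taken in `R`; only their common lower set is taken in `ρᵢ`.
      hull : ∀ i → Poset.Carrier (Gal R) → Pred (IncidenceStructure.E R) _
      hull i (X , _) = L (incidence (ρᵢ i)) (Upper R X)

    𝓛𝓢⇒𝓕𝓢 : (R : IncidenceStructure ℓ) → 𝓛𝓢 n (Gal R) → 𝓕𝓢 n R
    𝓛𝓢⇒𝓕𝓢 R (k , k≤n , _≤ᵢ_ , linear , ⊆⇔) =
      k , k≤n , (λ i x y → (_≤ᵢ_ i) (closure R x) (column R y)) ,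
      (λ i → represented⇒scatteredChain (linear⇒preorder (linear i))
               (closure R) (column R) λ _ _ → mk⇔ id id) ,
      λ x y → mk⇔ (λ xρy → to (⊆⇔ _ _) (to (ρ⇔closure⊆column R x y) xρy))
                  (λ h → from (ρ⇔closure⊆column R x y) (from (⊆⇔ _ _) h))

    module _ (P : Poset ℓ ℓ ℓ) where
      open Poset P hiding (refl; trans)

      -- A scattered linear order represents its own incidence structure by identity maps, so the
      -- realizer of `P` serves unchanged for `𝓕𝓢`.
      𝓛𝓢⇒𝓛𝓢-N : 𝓛𝓢 n P → 𝓛𝓢 n (N P)
      𝓛𝓢⇒𝓛𝓢-N (k , k≤n , _≤ᵢ_ , linear , ≤⇔) = 𝓕𝓢⇒𝓛𝓢 (incidence _≤_)
        ( k , k≤n , _≤ᵢ_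
        , (λ i → represented⇒scatteredChain (linear⇒preorder (linear i)) id id λ _ _ → mk⇔ id id)
        , ≤⇔ )

      -- Principal ideals embed `P` in `N P`, and the realizer is pulled back along them.
      𝓛𝓢-N⇒𝓛𝓢 : 𝓛𝓢 n (N P) → 𝓛𝓢 n P
      𝓛𝓢-N⇒𝓛𝓢 (k , k≤n , _≤ᵢ_ , linear , ⊆⇔) = preorders⇒𝓛𝓢 P n
        ( k , k≤n , (λ i → _≤ᵢ_ i on ↓)
        , (λ i → on-scattered ↓ (linear⇒preorder (linear i)))
        , λ x y → mk⇔ (λ x≤y → to (⊆⇔ (↓ x) (↓ y)) (λ {_} z≤x → Poset.trans P z≤x x≤y))
                      (λ h → from (⊆⇔ _ _) h (Poset.refl P)) )
        where
        ↓ : Carrier → Poset.Carrier (N P)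
        ↓ = column (incidence _≤_)

      -- Interval orders

      private
        R< : IncidenceStructure ℓ
        R< = incidence (strict P)

      𝓘𝓢⇒𝓛𝓢 : 𝓘𝓢 n P → 𝓛𝓢 n (Gal R<)
      𝓘𝓢⇒𝓛𝓢 (k , k≤n , _≤ᵢ_ , interval , ≤⇔) = 𝓕𝓢⇒𝓛𝓢 R<
        ( k , k≤n , (λ i → ToStrict._<_ _≈_ (_≤ᵢ_ i)) , (λ i → proj₂ (interval i))
        , λ x y → mk⇔ (λ (x≤y , x≉y) i → to (≤⇔ x y) x≤y i , x≉y)
                      -- The family is nonempty, so member `zero` can supply `x ≉ y`.
                      (λ h → from (≤⇔ x y) (λ i → proj₁ (h i)) , proj₂ (h zero)) )

      𝓛𝓢⇒𝓘𝓢 : 𝓛𝓢 n (Gal R<) → 𝓘𝓢 n P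
      𝓛𝓢⇒𝓘𝓢 (k , k≤n , _≤ᵢ_ , linear , ⊆⇔) =
        k , k≤n , (λ i → I._≤′_ i) ,
        (λ i → I.≤′-isPartialOrder i , I.chain i) ,
        λ x y → mk⇔ (below x y) (above x y)
        where
        module <P = IsStrictPartialOrder (ToStrict.<-isStrictPartialOrder _≈_ _≤_ isPartialOrder)

        below-set hull : Carrier → Poset.Carrier (Gal R<)
        below-set = column R<
        hull      = closure R<

        below-set-mono : ∀ {x y} → x ≈ y → proj₁ (below-set x) ⊆ proj₁ (below-set y)
        below-set-mono x≈y = <P.<-respʳ-≈ x≈y

        hull-mono : ∀ {x y} → x ≈ y → proj₁ (hull x) ⊆ proj₁ (hull y)
        hull-mono x≈y z∈ w y<w = z∈ w (<P.<-respˡ-≈ (Eq.sym x≈y) y<w)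

        module I (i : Fin (suc k)) where
          order : TotalOrder _ _ _
          order = record { isTotalOrder = proj₁ (linear i) }

          module O = TotalOrder order
          open O using () renaming (_≤_ to _⊴_)
          open Max order using (x≤x⊔y; x≤y⊔x; ⊔-lub; ⊔-mono-≤) renaming (_⊔_ to _∨_)
          open Min order using (_⊓_; x⊓y≤x; x⊓y≤y; ⊓-glb; ⊓-mono-≤)

          top bottom : Carrier → O.Carrier
          top    x = below-set x ∨ hull x
          bottom x = below-set x ⊓ hull x

          a⊴top : ∀ x → below-set x ⊴ top x
          a⊴top x = x≤x⊔y (below-set x) (hull x)

          b⊴top : ∀ x → hull x ⊴ top x
          b⊴top x = x≤y⊔x (below-set x) (hull x)

          bottom⊴a : ∀ x → bottom x ⊴ below-set x
          bottom⊴a x = x⊓y≤x (below-set x) (hull x)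

          bottom⊴b : ∀ x → bottom x ⊴ hull x
          bottom⊴b x = x⊓y≤y (below-set x) (hull x)

          -- An interval order: `x` stands for the interval from `bottom x` to `top x`. The
          -- comparison of endpoints can be non-strict because `below-set x` and `hull x` always
          -- differ.
          _<′_ : Rel Carrier _
          x <′ y = top x ⊴ bottom y

          -- When `x < y`, both `below-set x` and `hull x` are included in both `below-set y` and
          -- `hull y`.
          <⇒<′ : ∀ {x y} → strict P x y → x <′ y
          <⇒<′ {x} {y} x<y = ⊔-lub
            (⊓-glb (⊆⇒⊴ λ z<x → <P.trans z<x x<y)
                   (⊆⇒⊴ λ z<x w y<w → <P.trans z<x (<P.trans x<y y<w)))
            (⊓-glb (⊆⇒⊴ λ z∈ → z∈ y x<y)
                   (⊆⇒⊴ λ z∈ w y<w → <P.trans (z∈ y x<y) y<w))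
            where
            ⊆⇒⊴ : ∀ {U V} → proj₁ U ⊆ proj₁ V → U ⊴ V
            ⊆⇒⊴ U⊆V = to (⊆⇔ _ _) U⊆V i

          <′⇒b⊴a : ∀ {x y} → x <′ y → hull x ⊴ below-set y
          <′⇒b⊴a {x} {y} x<′y = O.trans (b⊴top x) (O.trans x<′y (bottom⊴a y))

          -- Otherwise `hull x` and `below-set x` would coincide, but `x` belongs to the first only.
          <′-irrefl : ∀ {x y} → x ≈ y → ¬ x <′ y
          <′-irrefl {x} {y} x≈y x<′y = <P.irrefl Eq.refl (proj₁ b≐a (λ _ → id))
            where
            b≐a : proj₁ (hull x) ≐ proj₁ (below-set x)
            b≐a = O.antisym
              (O.trans (<′⇒b⊴a x<′y) (to (⊆⇔ _ _) (below-set-mono (Eq.sym x≈y)) i))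
              (O.trans (a⊴top x) (O.trans x<′y (O.trans (bottom⊴b y)
                (to (⊆⇔ _ _) (hull-mono (Eq.sym x≈y)) i))))

          <′-trans : Transitive _<′_
          <′-trans {j = y} x<′y y<′z =
            O.trans x<′y (O.trans (bottom⊴a y) (O.trans (a⊴top y) y<′z))

          top-mono : ∀ {x y} → x ≈ y → top x ⊴ top y
          top-mono x≈y = ⊔-mono-≤ (to (⊆⇔ _ _) (below-set-mono x≈y) i)
                                  (to (⊆⇔ _ _) (hull-mono x≈y) i)

          bottom-mono : ∀ {x y} → x ≈ y → bottom x ⊴ bottom y
          bottom-mono x≈y = ⊓-mono-≤ (to (⊆⇔ _ _) (below-set-mono x≈y) i)
                                     (to (⊆⇔ _ _) (hull-mono x≈y) i)

          isStrict : IsStrictPartialOrder _≈_ _<′_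
          isStrict = record
            { isEquivalence = isEquivalence
            ; irrefl        = <′-irrefl
            ; trans         = <′-trans
            ; <-resp-≈      = (λ y≈z x<′y → O.trans x<′y (bottom-mono y≈z))
                            , (λ x≈y x<′z → O.trans (top-mono (Eq.sym x≈y)) x<′z)
            }

          open ToNonStrict _≈_ _<′_ public using () renaming (_≤_ to _≤′_)

          ≤′-isPartialOrder = ToNonStrict.isPartialOrder _≈_ _<′_ isStrict

          chain : ScatteredChain (Gal (incidence (ToStrict._<_ _≈_ _≤′_)))
          chain = represented⇒scatteredChain (linear⇒preorder (linear i)) top bottom λ x y → mk⇔
            (λ (x≤y , x≉y) → [ id , (λ x≈y → contradiction x≈y x≉y) ]′ x≤y)
            (λ x<′y → inj₁ x<′y , λ x≈y → <′-irrefl x≈y x<′y)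

        below : ∀ x y → x ≤ y → ∀ i → I._≤′_ i x y
        below x y x≤y i with em {P = x ≈ y}
        ... | yes x≈y = inj₂ x≈y
        ... | no  x≉y = inj₁ (I.<⇒<′ i (x≤y , x≉y))

        above : ∀ x y → (∀ i → I._≤′_ i x y) → x ≤ y
        above x y h with em {P = x ≈ y}
        ... | yes x≈y = reflexive x≈y
        -- `hull x` is below `below-set y` in every linear order, so it is included in it, which
        -- means `x < y`.
        ... | no  x≉y = proj₁ (from (ρ⇔closure⊆column R< x y) (from (⊆⇔ _ _) λ i →
          I.<′⇒b⊴a i ([ id , (λ x≈y → contradiction x≈y x≉y) ]′ (h i))))

theorem8 : (∀ {a} → ExcludedMiddle a) →
    {ℓ : Level} (n : ℤ) (R : IncidenceStructure ℓ) (P : Poset ℓ ℓ ℓ) →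
    (𝓕𝓢 n R ⇔ 𝓛𝓢 n (Gal R)) ×
    (𝓘𝓢 n P ⇔ 𝓛𝓢 n (Gal (incidence (strict P)))) ×
    (𝓛𝓢 n P ⇔ 𝓛𝓢 n (N P))
theorem8 em n R P =
  mk⇔ (𝓕𝓢⇒𝓛𝓢 em n R) (𝓛𝓢⇒𝓕𝓢 em n R) ,
  mk⇔ (𝓘𝓢⇒𝓛𝓢 em n P) (𝓛𝓢⇒𝓘𝓢 em n P) ,
  mk⇔ (𝓛𝓢⇒𝓛𝓢-N em n P) (𝓛𝓢-N⇒𝓛𝓢 em n P)
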